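{- Let $q$ be a power of a prime and let $b \in \mathbb{N}$. Then the number of linear bipermutive cellular automata (LBCA) $F:\mathbb{F}_q^{3b}\rightarrow \mathbb{F}_q^b$ whose associated hypercube $\mathcal{H}_F$ is a Latin cube is $q^{2(b-1)}(q-1)$.
   Context: $\mathbb{N}$ denotes the positive integers, $\mathbb{F}_q$ is the finite field with $q$ elements, and $[N]=\{1,\ldots,N\}$. Latin hypercube: for a finite set $X$ of $N$ elements, a Latin hypercube of dimension $k$ and order $N$ over $X$ is a $k$-dimensional array with entries from $X$ such that, whenever any $k-1$ of the $k$ coordinates are fixed, letting the remaining coordinate vary yields a permutation of $X$ (each element of $X$ appears exactly once). A Latin cube is a Latin hypercube of dimension $3$. Cellular automaton (CA): for $d\le n$ and $f:\mathbb{F}_q^d\to\mathbb{F}_q$, the CA of length $n$ and local rule $f$ is the map $F:\mathbb{F}_q^n\to\mathbb{F}_q^{n-d+1}$ with $F(x_1,\ldots,x_n) = (f(x_1,\ldots,x_d), f(x_2,\ldots,x_{d+1}),\ldots,f(x_{n-d+1},\ldots,x_n))$. LBCA: a CA whose local rule is of the form $f(x_1,\ldots,x_d)=x_1+a_2x_2+\cdots+a_{d-1}x_{d-1}+x_d$ with $a_2,\ldots,a_{d-1}\in\mathbb{F}_q$ (first and last coefficients equal to $1$). An LBCA $F:\mathbb{F}_q^{3b}\to\mathbb{F}_q^b$ has a local rule of $d=2b+1$ variables. Hypercube associated to a CA: the vectors in $\mathbb{F}_q^b$ are totally ordered, and $\Psi:[N]\to\mathbb{F}_q^b$, $N=q^b$,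 is the fixed monotone bijection. For a CA $F:\mathbb{F}_q^{bk}\to\mathbb{F}_q^b$ with local rule of $d=b(k-1)+1$ variables, $\mathcal{H}_F$ is the $k$-dimensional array of order $q^b$ with entries $\mathcal{H}_F(i_1,\ldots,i_k)=\Psi^{ -1}(F(\Psi(i_1)\,\|\,\cdots\,\|\,\Psi(i_k)))$ for $(i_1,\ldots,i_k)\in[N]^k$, where $\|$ is concatenation. Here $k=3$. -}

module Defs where

open import Algebra.Apartness.Bundles using (HeytingField; HeytingCommutativeRing)
open import Algebra.Bundles using (CommutativeRing)
import Algebra.Definitions.RawMonoid as RawMonoidDefinitions
open import Data.Fin.Base using (Fin; zero; fromℕ; fromℕ<; toℕ)
import Data.Fin.Base as Fin
open import Data.Fin.Properties using (toℕ<n; toℕ≤pred[n])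
open import Data.Nat.Base using (ℕ; suc; _+_; _*_; _^_)
open import Data.Nat.Primality using (Prime)
open import Data.Nat.Properties using (+-mono-<-≤)
open import Data.Product.Base using (Σ; Σ-syntax; ∃-syntax; _×_; proj₁)
open import Data.Vec.Base using (Vec; lookup; _[_]≔_)
open import Data.Vec.Functional using (Vector; concat)
import Data.Vec.Functional.Relation.Binary.Equality.Setoid as VectorEquality
open import Function.Bundles using (Inverse)
open import Function.Definitions using (Bijective)
open import Level using (_⊔_)
open import Relation.Binary.Bundles using (Setoid)
open import Relation.Binary.Core using (Rel)
open import Relation.Binary.Morphism.Structures using (IsOrderHomomorphism)
open import Relation.Binary.PropositionalEquality using (_≡_; setoid)

HasCardinality : ∀ {a ℓ} → Setoid a ℓ → ℕ → Set (a ⊔ ℓ)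
HasCardinality S n = Inverse S (setoid (Fin n))

IsPrimePower : ℕ → Set
IsPrimePower q = ∃[ p ] ∃[ m ] Prime p × q ≡ p ^ suc m

-- The line in direction j through the cell i: every coordinate of i except
-- the j-th is kept.
IsLatinHypercube : ∀ {x} {X : Set x} (k N : ℕ) → (Vec (Fin N) k → X) → Set x
IsLatinHypercube k N H =
  ∀ (j : Fin k) (i : Vec (Fin N) k) → Bijective _≡_ _≡_ (λ t → H (i [ j ]≔ t))

-- Position toℕ i + toℕ j: the j-th cell of the window starting at cell i.
windowIndex : ∀ {m e} → Fin m → Fin (suc e) → Fin (m + e)
windowIndex i j = fromℕ< (+-mono-<-≤ (toℕ<n i) (toℕ≤pred[n] j))

-- A cellular automaton of length n whose rule has d = suc e variables is given
-- by e and its output length m = n − d + 1, so that n = m + e.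
cellularAutomaton : ∀ {a} {A : Set a} m e →
                    (Vector A (suc e) → A) → Vector A (m + e) → Vector A m
cellularAutomaton m e f x i = f (λ j → x (windowIndex i j))

module _ {c ℓ₁ ℓ₂} (K : HeytingField c ℓ₁ ℓ₂) where

  open HeytingField K using (Carrier; _≈_; 1#; heytingCommutativeRing)
    renaming (_*_ to _·_)

  private
    ring : CommutativeRing c ℓ₁
    ring = HeytingCommutativeRing.commutativeRing heytingCommutativeRing

  open RawMonoidDefinitions (CommutativeRing.+-rawMonoid ring) using (sum)

  -- For a finite field the apartness relation is the negation of equality:
  -- invertibility is decidable there and the apartness is tight.
  fieldSetoid : Setoid c ℓ₁
  fieldSetoid = CommutativeRing.setoid ring

  open VectorEquality fieldSetoid using (_≋_; ≋-setoid; ≋-refl; ≋-sym; ≋-trans)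

  IsLinearBipermutive : ∀ e → (Vector Carrier (suc e) → Carrier) → Set (c ⊔ ℓ₁)
  IsLinearBipermutive e f =
    Σ[ a ∈ Vector Carrier (suc e) ]
      a zero ≈ 1# × a (fromℕ e) ≈ 1# × (∀ x → f x ≈ sum (λ i → a i · x i))

  IsLBCA : ∀ m e → (Vector Carrier (m + e) → Vector Carrier m) → Set (c ⊔ ℓ₁)
  IsLBCA m e F =
    ∃[ f ] IsLinearBipermutive e f × (∀ x → F x ≋ cellularAutomaton m e f x)

  record MonotoneBijection {ℓ₃} (b N : ℕ) (_⊑_ : Rel (Vector Carrier b) ℓ₃) :
                           Set (c ⊔ ℓ₁ ⊔ ℓ₃) where
    field
      inverse  : Inverse (setoid (Fin N)) (≋-setoid b)
    open Inverse inverse public using (to; from)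
    field
      monotone : IsOrderHomomorphism _≡_ _≋_ Fin._≤_ _⊑_ to

  hypercube : ∀ {ℓ₃ b N k} {_⊑_ : Rel (Vector Carrier b) ℓ₃} →
              MonotoneBijection b N _⊑_ →
              (Vector Carrier (k * b) → Vector Carrier b) →
              Vec (Fin N) k → Fin N
  hypercube Ψ F i = Ψ.from (F (concat (λ j → Ψ.to (lookup i j))))
    where module Ψ = MonotoneBijection Ψ

  -- The maps F themselves are counted, up to pointwise equality, and not the
  -- local rules or coefficient vectors that present them.  The type 3 * b
  -- computes to b + 2 * b, so the local rule has 2b + 1 variables.
  latinCubeLBCAs : ∀ {ℓ₃ b N} {_⊑_ : Rel (Vector Carrier b) ℓ₃} →
                   MonotoneBijection b N _⊑_ → Setoid (c ⊔ ℓ₁) (c ⊔ ℓ₁)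
  latinCubeLBCAs {b = b} {N} Ψ = record
    { Carrier = Σ (Vector Carrier (3 * b) → Vector Carrier b) λ F →
                  IsLBCA b (2 * b) F × IsLatinHypercube 3 N (hypercube {k = 3} Ψ F)
    ; _≈_ = λ F G → ∀ x → proj₁ F x ≋ proj₁ G x
    ; isEquivalence = record
      { refl  = λ x → ≋-refl
      ; sym   = λ F≈G x → ≋-sym (F≈G x)
      ; trans = λ F≈G G≈H x → ≋-trans (F≈G x) (G≈H x)
      }
    }

{-# OPTIONS --safe #-}
module Submission where

-- Reading the input backwards turns the linear rule a into multiplication by
-- the polynomial p = Σ aᵢ Xⁱ.  The array is Latin in direction j iff the only
-- polynomial w of degree < b for which the coefficients j b, …, (j+1) b − 1 of
-- p w vanish is w = 0.  For the outer directions this follows from the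
-- coefficients 1 at the two ends; for the middle one it is the regularity of a
-- b × b Toeplitz matrix with 2b − 1 free entries.
--
-- More generally let T(a, b) be the set of f modulo X^(a+b) such that no
-- nonzero w of degree < a makes the coefficients b, …, a+b−1 of f w vanish.
--   * If a ≤ b, the constant term of f is irrelevant: T(a, b) ≅ K × T(a, b−1).
--   * If a > b and f(0) = 0, then f/X ∈ T(a, b−1); for b = 0 this is impossible.
--   * If a > b and f(0) ≠ 0, then f ∈ T(a, b) iff 1/f ∈ T(b, a), and the first
--     case applies to 1/f, whose constant term is now a unit: K* × T(b, a−1).
-- By induction |T(a, b)| = (q − 1) q^(a+b−1) for a ≥ 1.

open import Defs
open import Algebra.Apartness.Bundles using (HeytingField; HeytingCommutativeRing)
open import Algebra.Bundles using (CommutativeRing)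
import Algebra.Definitions.RawMonoid as RawMonoidDefinitions
import Algebra.Properties.AbelianGroup as AbelianGroupProperties
import Algebra.Properties.CommutativeMonoid.Sum as CommutativeMonoidSum
import Algebra.Properties.CommutativeSemigroup as CommutativeSemigroupProperties
import Algebra.Properties.Group as GroupProperties
import Algebra.Properties.Ring as RingProperties
open import Data.Fin.Base as Fin
  using (Fin; zero; suc; toℕ; fromℕ; fromℕ<; inject₁; opposite; combine; remQuot; punchIn; punchOut)
open import Data.Fin.Properties as Fin
  using (+↔⊎; *↔×; any?; injective⇒≤; toℕ<n; toℕ≤pred[n]; toℕ-fromℕ; toℕ-fromℕ<; toℕ-inject₁;
         toℕ-combine; combine-remQuot; opposite-prop; opposite-involutive; punchInᵢ≢i;
         punchOut-cong; punchOut-injective; punchOut-punchIn; punchIn-punchOut)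
open import Data.Nat.Base
  using (ℕ; zero; suc; NonZero; _+_; _*_; _∸_; _^_; _≤_; _<_; z≤n; s≤s; s≤s⁻¹)
open import Data.Nat.Properties as ℕ
  using (≤-refl; ≤-trans; ≤-<-trans; m≤n⇒m≤1+n; m≤n⇒m<n∨m≡n; _≤?_; _<?_; ≮⇒≥; ≰⇒>; <-cmp)
open import Data.Nat.Tactic.RingSolver using (solve-∀)
open import Data.Product.Base using (∃; _×_; _,_; proj₁; proj₂)
open import Data.Product.Function.NonDependent.Setoid using (_×-inverse_)
open import Data.Product.Relation.Binary.Pointwise.NonDependent using (×-setoid; Pointwise-≡↔≡)
open import Data.Sum.Base using (_⊎_; inj₁; inj₂)
open import Data.Sum.Function.Setoid using (_⊎-inverse_)
open import Data.Sum.Relation.Binary.Pointwise as Sum using (⊎-setoid)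
open import Data.Vec.Base using (Vec; replicate; lookup; _[_]≔_)
open import Data.Vec.Functional using (Vector; _∷_; concat)
import Data.Vec.Functional.Relation.Binary.Equality.Setoid as VectorEquality
open import Data.Vec.Functional.Relation.Binary.Equality.Setoid using (_≋_)
open import Data.Vec.Properties using (lookup∘update; lookup∘update′)
open import Function.Base using (_∘_)
open import Function.Bundles using (Inverse; _⇔_; mk⇔; module Equivalence)
import Function.Consequences.Setoid as Consequences
import Function.Construct.Composition as Composition
import Function.Construct.Symmetry as Symmetry
open import Function.Definitions using (Injective; Bijective)
open import Level using (Level)
open import Relation.Binary.Bundles using (Setoid)
import Relation.Binary.Construct.On as On
open import Relation.Binary.Core using (Rel)
open import Relation.Binary.Definitions using (tri<; tri≈; tri>)
open import Relation.Binary.PropositionalEquality as ≡ using (_≡_; _≢_)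
open import Relation.Binary.Structures using (IsTotalOrder)
open import Relation.Nullary using (Dec; yes; no; contradiction)
open import Relation.Nullary.Decidable using (map′)

-- Power series

module Series {c ℓ} (R : CommutativeRing c ℓ) where

  open CommutativeRing R hiding (zero) renaming (_*_ to _·_; _+_ to _⊹_)
  open CommutativeSemigroupProperties +-commutativeSemigroup using (x∙yz≈y∙xz; interchange)
  open AbelianGroupProperties +-abelianGroup using (xyx⁻¹≈y)
  open import Relation.Binary.Reasoning.Setoid setoid

  Series : Set c
  Series = ℕ → Carrier

  shiftDown : Series → Series
  shiftDown f = f ∘ suc

  infixl 7 _⊛_

  -- The Cauchy product, by recursion on `f = f 0 + X · shiftDown f`; this form needs no finite
  -- sums.
  _⊛_ : Series → Series → Series
  (f ⊛ g) zero    = f 0 · g 0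
  (f ⊛ g) (suc n) = f 0 · g (suc n) ⊹ (shiftDown f ⊛ g) n

  𝟘 𝟙 : Series
  𝟘 _       = 0#
  𝟙 zero    = 1#
  𝟙 (suc _) = 0#

  -- Coefficient `n` of a product involves only coefficients up to `n` of the factors. Asking for
  -- agreement only that far is what permits work modulo a power of X.
  ⊛-cong : ∀ {f f′ g g′} n → (∀ i → i ≤ n → f i ≈ f′ i) → (∀ i → i ≤ n → g i ≈ g′ i) →
           (f ⊛ g) n ≈ (f′ ⊛ g′) n
  ⊛-cong zero    f≈ g≈ = *-cong (f≈ 0 z≤n) (g≈ 0 z≤n)
  ⊛-cong (suc n) f≈ g≈ = +-cong
    (*-cong (f≈ 0 z≤n) (g≈ (suc n) ≤-refl))
    (⊛-cong n (λ i i≤n → f≈ (suc i) (s≤s i≤n)) (λ i i≤n → g≈ i (m≤n⇒m≤1+n i≤n)))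

  ⊛-zeroˡ : ∀ {f} g n → (∀ i → i ≤ n → f i ≈ 0#) → (f ⊛ g) n ≈ 0#
  ⊛-zeroˡ g zero    f≈0 = trans (*-congʳ (f≈0 0 z≤n)) (zeroˡ _)
  ⊛-zeroˡ g (suc n) f≈0 = trans
    (+-cong (trans (*-congʳ (f≈0 0 z≤n)) (zeroˡ _)) (⊛-zeroˡ g n λ i i≤n → f≈0 (suc i) (s≤s i≤n)))
    (+-identityˡ 0#)

  -- The definition peels off the head of the left factor; peeling off that of the right one is the
  -- induction step of commutativity.
  ⊛-suc : ∀ f g n → (f ⊛ g) (suc n) ≈ f (suc n) · g 0 ⊹ (f ⊛ shiftDown g) n
  ⊛-suc f g zero    = +-comm _ _
  ⊛-suc f g (suc n) = trans (+-congˡ (⊛-suc (shiftDown f) g n)) (x∙yz≈y∙xz _ _ _)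

  ⊛-comm : ∀ f g n → (f ⊛ g) n ≈ (g ⊛ f) n
  ⊛-comm f g zero    = *-comm _ _
  ⊛-comm f g (suc n) = trans (⊛-suc f g n) (+-cong (*-comm _ _) (⊛-comm f (shiftDown g) n))

  ⊛-zeroʳ : ∀ f {g} n → (∀ i → i ≤ n → g i ≈ 0#) → (f ⊛ g) n ≈ 0#
  ⊛-zeroʳ f {g} n g≈0 = trans (⊛-comm f g n) (⊛-zeroˡ f n g≈0)

  -- The left factor has the shape of the tail of a product, `f 0 · shiftDown g` plus
  -- `shiftDown f ⊛ g`, as associativity requires.
  ⊛-linearˡ : ∀ x f g h n → ((λ i → x · f i ⊹ g i) ⊛ h) n ≈ x · (f ⊛ h) n ⊹ (g ⊛ h) n
  ⊛-linearˡ x f g h zero    = trans (distribʳ _ _ _) (+-congʳ (*-assoc _ _ _))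
  ⊛-linearˡ x f g h (suc n) = begin
    (x · f 0 ⊹ g 0) · h (suc n) ⊹ ((λ i → x · f (suc i) ⊹ g (suc i)) ⊛ h) n
      ≈⟨ +-cong (trans (distribʳ _ _ _) (+-congʳ (*-assoc _ _ _)))
                (⊛-linearˡ x (shiftDown f) (shiftDown g) h n) ⟩
    (x · (f 0 · h (suc n)) ⊹ g 0 · h (suc n)) ⊹ (x · (shiftDown f ⊛ h) n ⊹ (shiftDown g ⊛ h) n)
      ≈⟨ interchange _ _ _ _ ⟩
    (x · (f 0 · h (suc n)) ⊹ x · (shiftDown f ⊛ h) n) ⊹ (g 0 · h (suc n) ⊹ (shiftDown g ⊛ h) n)
      ≈⟨ +-congʳ (distribˡ _ _ _) ⟨
    x · (f ⊛ h) (suc n) ⊹ (g ⊛ h) (suc n) ∎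

  ⊛-assoc : ∀ f g h n → ((f ⊛ g) ⊛ h) n ≈ (f ⊛ (g ⊛ h)) n
  ⊛-assoc f g h zero    = *-assoc _ _ _
  ⊛-assoc f g h (suc n) = begin
    f 0 · g 0 · h (suc n) ⊹ ((λ i → f 0 · g (suc i) ⊹ (shiftDown f ⊛ g) i) ⊛ h) n
      ≈⟨ +-cong (*-assoc _ _ _) (⊛-linearˡ (f 0) (shiftDown g) (shiftDown f ⊛ g) h n) ⟩
    f 0 · (g 0 · h (suc n)) ⊹ (f 0 · (shiftDown g ⊛ h) n ⊹ ((shiftDown f ⊛ g) ⊛ h) n)
      ≈⟨ +-assoc _ _ _ ⟨
    f 0 · (g 0 · h (suc n)) ⊹ f 0 · (shiftDown g ⊛ h) n ⊹ ((shiftDown f ⊛ g) ⊛ h) n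
      ≈⟨ +-cong (sym (distribˡ _ _ _)) (⊛-assoc (shiftDown f) g h n) ⟩
    f 0 · (g ⊛ h) (suc n) ⊹ (shiftDown f ⊛ (g ⊛ h)) n ∎

  ⊛-identityˡ : ∀ f n → (𝟙 ⊛ f) n ≈ f n
  ⊛-identityˡ f zero    = *-identityˡ _
  ⊛-identityˡ f (suc n) =
    trans (+-cong (*-identityˡ _) (⊛-zeroˡ f n λ _ _ → refl)) (+-identityʳ _)

  -- Multiplication by powers of X, and degree bounds

  shiftUp : ℕ → Series → Series
  shiftUp zero    f         = f
  shiftUp (suc m) f zero    = 0#
  shiftUp (suc m) f (suc n) = shiftUp m f n

  shiftUp-+ : ∀ m f n → shiftUp m f (m + n) ≡ f n
  shiftUp-+ zero    f n = ≡.refl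
  shiftUp-+ (suc m) f n = shiftUp-+ m f n

  shiftUp-< : ∀ m f {n} → n < m → shiftUp m f n ≡ 0#
  shiftUp-< (suc m) f {zero}  _         = ≡.refl
  shiftUp-< (suc m) f {suc n} (s≤s n<m) = shiftUp-< m f n<m

  ⊛-shiftUp : ∀ m f g n → (f ⊛ shiftUp m g) (m + n) ≈ (f ⊛ g) n
  ⊛-shiftUp zero    f g n = refl
  ⊛-shiftUp (suc m) f g n = begin
    (f ⊛ shiftUp (suc m) g) (suc (m + n))           ≈⟨ ⊛-suc f _ (m + n) ⟩
    f (suc (m + n)) · 0# ⊹ (f ⊛ shiftUp m g) (m + n) ≈⟨ +-cong (zeroʳ _) (⊛-shiftUp m f g n) ⟩
    0# ⊹ (f ⊛ g) n                                      ≈⟨ +-identityˡ _ ⟩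
    (f ⊛ g) n ∎

  infix 4 _<deg_

  _<deg_ : Series → ℕ → Set ℓ
  w <deg a = ∀ i → a ≤ i → w i ≈ 0#

  truncate : ℕ → Series → Series
  truncate zero    f         = 𝟘
  truncate (suc a) f zero    = f 0
  truncate (suc a) f (suc i) = truncate a (shiftDown f) i

  truncate-<deg : ∀ a f → truncate a f <deg a
  truncate-<deg zero    f i       _         = refl
  truncate-<deg (suc a) f (suc i) (s≤s a≤i) = truncate-<deg a (shiftDown f) i a≤i

  truncate-< : ∀ a f {i} → i < a → truncate a f i ≡ f i
  truncate-< (suc a) f {zero}  _         = ≡.refl
  truncate-< (suc a) f {suc i} (s≤s i<a) = truncate-< a (shiftDown f) i<a

  -- While `e` is positive, the head of `f` meets a coefficient of `g` above its degree bound; at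
  -- `e = 0` the tail of `f` vanishes.
  ⊛-leading : ∀ {f g} e m → f <deg suc e → g <deg suc m → (f ⊛ g) (e + m) ≈ f e · g m
  ⊛-leading             zero    zero    f< g< = refl
  ⊛-leading {g = g}     zero    (suc m) f< g< =
    trans (+-congˡ (⊛-zeroˡ g m λ i _ → f< (suc i) (s≤s z≤n))) (+-identityʳ _)
  ⊛-leading {f} {g}     (suc e) m       f< g< = trans
    (+-cong (trans (*-congˡ (g< _ (s≤s (ℕ.m≤n+m m e)))) (zeroʳ _))
            (⊛-leading {shiftDown f} {g} e m (λ i e<i → f< (suc i) (s≤s e<i)) g<))
    (+-identityˡ _)

  -- Inverses modulo a power of X, and regular Toeplitz systems

  InverseMod : ℕ → Series → Series → Set ℓ
  InverseMod n f g = ∀ i → i < n → (f ⊛ g) i ≈ 𝟙 i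

  inverseMod-sym : ∀ {n f g} → InverseMod n f g → InverseMod n g f
  inverseMod-sym {f = f} {g} fg≈1 i i<n = trans (⊛-comm g f i) (fg≈1 i i<n)

  inverseMod-cong : ∀ {n f f′ g} → (∀ i → i < n → f i ≈ f′ i) →
                    InverseMod n f g → InverseMod n f′ g
  inverseMod-cong {g = g} f≈f′ fg≈1 i i<n = trans
    (⊛-cong {g = g} i (λ j j≤i → sym (f≈f′ j (≤-<-trans j≤i i<n))) (λ _ _ → refl))
    (fg≈1 i i<n)

  ⊛-cancel : ∀ {n f g} → InverseMod n f g → ∀ h i → i < n → (f ⊛ (g ⊛ h)) i ≈ h i
  ⊛-cancel {f = f} {g} fg≈1 h i i<n = begin
    (f ⊛ (g ⊛ h)) i ≈⟨ ⊛-assoc f g h i ⟨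
    ((f ⊛ g) ⊛ h) i ≈⟨ ⊛-cong {g = h} i (λ j j≤i → fg≈1 j (≤-<-trans j≤i i<n)) (λ _ _ → refl) ⟩
    (𝟙 ⊛ h) i       ≈⟨ ⊛-identityˡ h i ⟩
    h i ∎

  -- The usual f = f (g h) = (f g) h = h. It makes inversion of vectors both well defined and
  -- involutive.
  inverseMod-unique : ∀ {n f g h} → InverseMod n f g → InverseMod n g h →
                      ∀ i → i < n → f i ≈ h i
  inverseMod-unique {f = f} {g} {h} fg≈1 gh≈1 i i<n = begin
    f i             ≈⟨ ⊛-identityˡ f i ⟨
    (𝟙 ⊛ f) i       ≈⟨ ⊛-comm 𝟙 f i ⟩
    (f ⊛ 𝟙) i       ≈⟨ ⊛-cong {f} i (λ _ _ → refl) (λ j j≤i → sym (gh≈1 j (≤-<-trans j≤i i<n))) ⟩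
    (f ⊛ (g ⊛ h)) i ≈⟨ ⊛-cancel {g = g} fg≈1 h i i<n ⟩
    h i ∎

  Unit : Carrier → Set _
  Unit x = ∃ λ y → y · x ≈ 1#

  module _ (f : Series) (u : Unit (f 0)) where

    private
      y : Carrier
      y = proj₁ u

    -- Division of `h` by `f` from the lowest coefficient upwards: subtracting `y · h 0` times `f`
    -- kills the constant term, and the remainder divided by X is treated in the same way.
    quotient : Series → Series
    quotient h zero    = y · h 0
    quotient h (suc n) = quotient (λ i → h (suc i) - y · h 0 · f (suc i)) n

    quotient-⊛ : ∀ h n → (quotient h ⊛ f) n ≈ h n
    quotient-⊛ h zero    = begin
      y · h 0 · f 0   ≈⟨ *-congʳ (*-comm y (h 0)) ⟩
      h 0 · y · f 0   ≈⟨ *-assoc _ _ _ ⟩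
      h 0 · (y · f 0) ≈⟨ *-congˡ (proj₂ u) ⟩
      h 0 · 1#        ≈⟨ *-identityʳ _ ⟩
      h 0 ∎
    quotient-⊛ h (suc n) =
      trans (+-congˡ (quotient-⊛ (λ i → h (suc i) - y · h 0 · f (suc i)) n))
            (trans (sym (+-assoc _ _ _)) (xyx⁻¹≈y _ _))

    reciprocal : Series
    reciprocal = quotient 𝟙

    reciprocal-inverseMod : ∀ n → InverseMod n f reciprocal
    reciprocal-inverseMod n = inverseMod-sym {n} {reciprocal} (λ i _ → quotient-⊛ 𝟙 i)

    reciprocal-unit : Unit (reciprocal 0)
    reciprocal-unit = f 0 , trans (*-comm _ _) (quotient-⊛ 𝟙 0)

  -- The Toeplitz system (f w)ᵢ = 0, b ≤ i < n, has only the trivial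
  -- solution; it is square when a + b ≡ n.
  Regular : ℕ → Series → ℕ → ℕ → Set _
  Regular n f a b = ∀ w → w <deg a → (∀ i → b ≤ i → i < n → (f ⊛ w) i ≈ 0#) → ∀ i → w i ≈ 0#

  regular-cong : ∀ {n f f′ a b} → (∀ i → i < n → f i ≈ f′ i) → Regular n f a b → Regular n f′ a b
  regular-cong f≈f′ reg w w< fw≈0 = reg w w< λ i b≤i i<n → trans
    (⊛-cong {g = w} i (λ j j≤i → f≈f′ j (≤-<-trans j≤i i<n)) (λ _ _ → refl))
    (fw≈0 i b≤i i<n)

  regular-zero : ∀ n f b → Regular n f 0 b
  regular-zero n f b w w< _ i = w< i z≤n

  -- Row `suc i` for `f` is row `i` for `shiftDown f` plus `f 0 · w (suc i)`. For `b ≤ i` this term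
  -- vanishes, either with `f 0` or because `suc i` is at least the degree bound `a`.
  regular-shiftDown : ∀ {n f a b} → f 0 ≈ 0# ⊎ a ≤ suc b →
                      Regular (suc n) f a (suc b) ⇔ Regular n (shiftDown f) a b
  regular-shiftDown {n} {f} {a} {b} h = mk⇔
    (λ reg w w< fw≈0 → reg w w< λ
      { (suc i) (s≤s b≤i) (s≤s i<n) → trans (drop w w< i b≤i) (fw≈0 i b≤i i<n) })
    (λ reg w w< fw≈0 → reg w w< λ i b≤i i<n →
      trans (sym (drop w w< i b≤i)) (fw≈0 (suc i) (s≤s b≤i) (s≤s i<n)))
    where
    head≈0 : f 0 ≈ 0# ⊎ a ≤ suc b → ∀ w → w <deg a → ∀ i → b ≤ i → f 0 · w (suc i) ≈ 0#
    head≈0 (inj₁ f₀≈0) w w< i b≤i = trans (*-congʳ f₀≈0) (zeroˡ _)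
    head≈0 (inj₂ a≤b)  w w< i b≤i =
      trans (*-congˡ (w< (suc i) (≤-trans a≤b (s≤s b≤i)))) (zeroʳ _)

    drop : ∀ w → w <deg a → ∀ i → b ≤ i → (f ⊛ w) (suc i) ≈ (shiftDown f ⊛ w) i
    drop w w< i b≤i = trans (+-congʳ (head≈0 h w w< i b≤i)) (+-identityˡ _)

  -- If r is a kernel vector for g = 1/f, then g r, truncated, is one for f,
  -- and r is recovered from it as f (g r).
  regular-inverse : ∀ {n f g a b} → InverseMod n f g → b ≤ n →
                    Regular n f a b → Regular n g b a
  regular-inverse {n} {f} {g} {a} {b} fg≈1 b≤n reg r r< gr≈0 i with i <? n
  ... | no  i≮n = r< i (≤-trans b≤n (≮⇒≥ i≮n))
  ... | yes i<n = trans (sym (fw≈r i i<n)) (⊛-zeroʳ f i λ j _ → w≈0 j)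
    where
    w : Series
    w = truncate a (g ⊛ r)

    w≈gr : ∀ j → j < n → w j ≈ (g ⊛ r) j
    w≈gr j j<n with j <? a
    ... | yes j<a = reflexive (truncate-< a (g ⊛ r) j<a)
    ... | no  j≮a = trans (truncate-<deg a (g ⊛ r) j (≮⇒≥ j≮a)) (sym (gr≈0 j (≮⇒≥ j≮a) j<n))

    fw≈r : ∀ j → j < n → (f ⊛ w) j ≈ r j
    fw≈r j j<n = trans
      (⊛-cong {f} j (λ _ _ → refl) (λ k k≤j → w≈gr k (≤-<-trans k≤j j<n)))
      (⊛-cancel {g = g} fg≈1 r j j<n)

    w≈0 : ∀ j → w j ≈ 0#
    w≈0 = reg w (truncate-<deg a (g ⊛ r)) λ j b≤j j<n → trans (fw≈r j j<n) (r< j b≤j)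

  -- If `f 0` were zero, then X^n would be a kernel vector: all coefficients of f X^n up to index
  -- `n` vanish.
  regular⇒head≉0 : ∀ {n f} → 1# ≉ 0# → Regular (suc n) f (suc n) 0 → f 0 ≉ 0#
  regular⇒head≉0 {n} {f} 1≉0 reg f₀≈0 = 1≉0 (trans (sym (reflexive w[n]≡1)) (reg w w< fw≈0 (n + 0)))
    where
    w : Series
    w = shiftUp n 𝟙

    w[n]≡1 : w (n + 0) ≡ 1#
    w[n]≡1 = shiftUp-+ n 𝟙 0

    w< : w <deg suc n
    w< i n<i with k , ≡.refl ← ℕ.m≤n⇒∃[o]m+o≡n n<i = reflexive
      (≡.trans (≡.cong w (≡.sym (ℕ.+-suc n k))) (shiftUp-+ n 𝟙 (suc k)))

    fw≈0 : ∀ i → 0 ≤ i → i < suc n → (f ⊛ w) i ≈ 0#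
    fw≈0 i _ (s≤s i≤n) with m≤n⇒m<n∨m≡n i≤n
    ... | inj₁ i<n    = ⊛-zeroʳ f i λ j j≤i → reflexive (shiftUp-< n 𝟙 (≤-<-trans j≤i i<n))
    ... | inj₂ ≡.refl = begin
      (f ⊛ w) n         ≡⟨ ≡.cong (f ⊛ w) (ℕ.+-identityʳ n) ⟨
      (f ⊛ w) (n + 0) ≈⟨ ⊛-shiftUp n f 𝟙 0 ⟩
      f 0 · 1#          ≈⟨ *-congʳ f₀≈0 ⟩
      0# · 1#           ≈⟨ zeroˡ _ ⟩
      0# ∎

  -- Series with prescribed initial coefficients

  infixr 5 _▹_

  -- `v ▹ 𝟘` is the polynomial with coefficient vector `v`, and `v ▹ 𝟙` has one further coefficient
  -- 1.
  _▹_ : ∀ {n} → Vector Carrier n → Series → Series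
  _▹_ {zero}  v s         = s
  _▹_ {suc n} v s zero    = v zero
  _▹_ {suc n} v s (suc k) = ((v ∘ suc) ▹ s) k

  ▹-toℕ : ∀ {n} (v : Vector Carrier n) s i → (v ▹ s) (toℕ i) ≡ v i
  ▹-toℕ v s zero    = ≡.refl
  ▹-toℕ v s (suc i) = ▹-toℕ (v ∘ suc) s i

  ▹-+ : ∀ n (v : Vector Carrier n) s k → (v ▹ s) (n + k) ≡ s k
  ▹-+ zero    v s k = ≡.refl
  ▹-+ (suc n) v s k = ▹-+ n (v ∘ suc) s k

  ▹-<deg : ∀ {n} (v : Vector Carrier n) → v ▹ 𝟘 <deg n
  ▹-<deg {n} v i n≤i with k , ≡.refl ← ℕ.m≤n⇒∃[o]m+o≡n n≤i = reflexive (▹-+ n v 𝟘 k)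

  ▹-cong : ∀ {n} {v v′ : Vector Carrier n} s s′ → (∀ i → v i ≈ v′ i) →
           ∀ k → k < n → (v ▹ s) k ≈ (v′ ▹ s′) k
  ▹-cong s s′ v≈v′ zero    (s≤s _)   = v≈v′ zero
  ▹-cong s s′ v≈v′ (suc k) (s≤s k<n) = ▹-cong s s′ (v≈v′ ∘ suc) k k<n

  restrict-▹ : ∀ {n} f s k → k < n → ((λ (i : Fin n) → f (toℕ i)) ▹ s) k ≡ f k
  restrict-▹ f s zero    (s≤s _)   = ≡.refl
  restrict-▹ f s (suc k) (s≤s k<n) = restrict-▹ (shiftDown f) s k k<n

-- Cardinalities

private
  variable
    a₁ a₂ ℓ₁ ℓ₂ : Level
    S : Setoid a₁ ℓ₁
    T : Setoid a₂ ℓ₂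

mkInverse : (S : Setoid a₁ ℓ₁) (T : Setoid a₂ ℓ₂) → let module S = Setoid S; module T = Setoid T in
            (to : S.Carrier → T.Carrier) (from : T.Carrier → S.Carrier) →
            (∀ x y → x S.≈ y → to x T.≈ to y) → (∀ x y → x T.≈ y → from x S.≈ from y) →
            (∀ x → to (from x) T.≈ x) → (∀ x → from (to x) S.≈ x) → Inverse S T
mkInverse S T to from to-cong from-cong to∘from from∘to = record
  { to        = to
  ; from      = from
  ; to-cong   = to-cong _ _
  ; from-cong = from-cong _ _
  ; inverse   = strictlyInverseˡ⇒inverseˡ {f = to} (to-cong _ _) to∘from
              , strictlyInverseʳ⇒inverseʳ {f⁻¹ = from} (from-cong _ _) from∘to
  } where open Consequences S T

cardinality-↔ : ∀ {n} → Inverse S T → HasCardinality T n → HasCardinality S n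
cardinality-↔ = Composition.inverse

cardinality-× : ∀ {m n} → HasCardinality S m → HasCardinality T n →
                HasCardinality (×-setoid S T) (m * n)
cardinality-× |S| |T| = Composition.inverse (|S| ×-inverse |T|)
  (Composition.inverse Pointwise-≡↔≡ (Symmetry.inverse *↔×))

cardinality-⊎ : ∀ {m n} → HasCardinality S m → HasCardinality T n →
                HasCardinality (⊎-setoid S T) (m + n)
cardinality-⊎ |S| |T| = Composition.inverse (|S| ⊎-inverse |T|)
  (Composition.inverse (Sum.Pointwise-≡↔≡ _ _) (Symmetry.inverse +↔⊎))

cardinality-≡ : ∀ {m n} → m ≡ n → HasCardinality S m → HasCardinality S n
cardinality-≡ {S = S} = ≡.subst (HasCardinality S)

-- Over a field with suc q elements; only used for a ≤ n, so the 0 is junk.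
regularCount : ℕ → ℕ → ℕ → ℕ
regularCount q n       zero    = suc q ^ n
regularCount q zero    (suc a) = 0
regularCount q (suc n) (suc a) = suc q ^ n * q

regularCount-suc : ∀ q n a → a ≤ n → suc q * regularCount q n a ≡ regularCount q (suc n) a
regularCount-suc q n       zero    _ = ≡.refl
regularCount-suc q (suc n) (suc a) _ = ≡.sym (ℕ.*-assoc (suc q) (suc q ^ n) q)

-- Counting regular Toeplitz systems over a finite field

module FiniteField {c ℓ} (R : CommutativeRing c ℓ) where

  open CommutativeRing R hiding (zero) renaming (_*_ to _·_; _+_ to _⊹_)
  open Series R
  open VectorEquality setoid using (≋-setoid)

  -- In this setoid and the next two only the first components are compared, so that elements and
  -- vectors are counted and not the evidence attached to them.
  unitSetoid : Setoid _ _
  unitSetoid = On.setoid setoid (proj₁ {B = Unit})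

  regularSetoid : ℕ → ℕ → ℕ → Setoid _ _
  regularSetoid n a b =
    On.setoid (≋-setoid n) (proj₁ {B = λ v → Regular n (v ▹ 𝟘) a b})

  unitRegularSetoid : ℕ → ℕ → ℕ → Setoid _ _
  unitRegularSetoid n a b =
    On.setoid (≋-setoid (suc n)) (proj₁ {B = λ v → Unit (v zero) × Regular (suc n) (v ▹ 𝟘) a b})

  module _ (zero⊎unit : ∀ x → x ≈ 0# ⊎ Unit x) (1≉0 : 1# ≉ 0#)
           {q : ℕ} (|R| : HasCardinality setoid (suc q)) where

    private
      module |R| = Inverse |R|

    unit⇒≉0 : ∀ {x} → Unit x → x ≉ 0#
    unit⇒≉0 (y , yx≈1) x≈0 = 1≉0 (trans (sym yx≈1) (trans (*-congˡ x≈0) (zeroʳ y)))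

    ≉0⇒unit : ∀ {x} → x ≉ 0# → Unit x
    ≉0⇒unit {x} x≉0 with zero⊎unit x
    ... | inj₁ x≈0 = contradiction x≈0 x≉0
    ... | inj₂ u   = u

    -- `punchOut` removes the index of `0#`; every remaining element is a unit.
    cardinality-unit : HasCardinality unitSetoid q
    cardinality-unit = mkInverse unitSetoid (≡.setoid (Fin q))
      (λ (x , u) → punchOut (to≢ u))
      (λ i → |R|.from (punchIn (|R|.to 0#) i) , ≉0⇒unit (from≉ i))
      (λ (x , u) (y , v) x≈y → punchOut-cong (|R|.to 0#) (|R|.to-cong x≈y))
      (λ i j i≡j → reflexive (≡.cong (|R|.from ∘ punchIn (|R|.to 0#)) i≡j))
      (λ i → ≡.trans (punchOut-cong (|R|.to 0#) {i≢k = punchInᵢ≢i _ i ∘ ≡.sym} (|R|.strictlyInverseˡ _))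
                     (punchOut-punchIn (|R|.to 0#)))
      (λ (x , u) → trans (reflexive (≡.cong |R|.from (punchIn-punchOut (to≢ u)))) (|R|.strictlyInverseʳ x))
      where
      to≢ : ∀ {x} → Unit x → |R|.to 0# ≢ |R|.to x
      to≢ {x} u eq = unit⇒≉0 u (trans (sym (|R|.strictlyInverseʳ x))
        (trans (reflexive (≡.cong |R|.from (≡.sym eq))) (|R|.strictlyInverseʳ 0#)))

      from≉ : ∀ i → |R|.from (punchIn (|R|.to 0#) i) ≉ 0#
      from≉ i eq = punchInᵢ≢i (|R|.to 0#) i
        (≡.trans (≡.sym (|R|.strictlyInverseˡ _)) (|R|.to-cong eq))

    regular-∷ : ∀ {n a b} → a ≤ suc b →
                Inverse (regularSetoid (suc n) a (suc b)) (×-setoid setoid (regularSetoid n a b))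
    regular-∷ {n} {a} {b} a≤1+b = mkInverse
      (regularSetoid (suc n) a (suc b)) (×-setoid setoid (regularSetoid n a b))
      (λ (v , reg) → v zero , v ∘ suc , Equivalence.to (regular-shiftDown (inj₂ a≤1+b)) reg)
      (λ (x , v , reg) → x ∷ v , Equivalence.from (regular-shiftDown {f = (x ∷ v) ▹ 𝟘} (inj₂ a≤1+b)) reg)
      (λ _ _ v≈w → v≈w zero , v≈w ∘ suc)
      (λ _ _ (x≈y , v≈w) → λ { zero → x≈y ; (suc i) → v≈w i })
      (λ _ → refl , λ _ → refl)
      (λ _ → λ { zero → refl ; (suc i) → refl })

    -- For `b = 0` a vanishing constant term is excluded, so the branch that divides by X is absent.
    regular-full : ∀ {n} → Inverse (regularSetoid (suc n) (suc n) 0) (unitRegularSetoid n (suc n) 0)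
    regular-full {n} = mkInverse (regularSetoid (suc n) (suc n) 0) (unitRegularSetoid n (suc n) 0)
      (λ (v , reg) → v , ≉0⇒unit (regular⇒head≉0 {f = v ▹ 𝟘} 1≉0 reg) , reg)
      (λ (v , _ , reg) → v , reg)
      (λ _ _ v≈w → v≈w) (λ _ _ v≈w → v≈w) (λ _ _ → refl) (λ _ _ → refl)

    -- A zero constant term is divided out; a unit one is kept together with its inverse.
    regular-split : ∀ {n a b} → Inverse (regularSetoid (suc n) a (suc b))
                                        (⊎-setoid (regularSetoid n a b) (unitRegularSetoid n a (suc b)))
    regular-split {n} {a} {b} = mkInverse
      (regularSetoid (suc n) a (suc b)) (⊎-setoid (regularSetoid n a b) (unitRegularSetoid n a (suc b)))
      to from to-cong from-cong to∘from from∘to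
      where
      module A = Setoid (regularSetoid (suc n) a (suc b))
      module U = Setoid (⊎-setoid (regularSetoid n a b) (unitRegularSetoid n a (suc b)))

      to : A.Carrier → U.Carrier
      to (v , reg) with zero⊎unit (v zero)
      ... | inj₁ v₀≈0 = inj₁ (v ∘ suc , Equivalence.to (regular-shiftDown (inj₁ v₀≈0)) reg)
      ... | inj₂ u    = inj₂ (v , u , reg)

      from : U.Carrier → A.Carrier
      from (inj₁ (v , reg))     =
        0# ∷ v , Equivalence.from (regular-shiftDown {f = (0# ∷ v) ▹ 𝟘} (inj₁ refl)) reg
      from (inj₂ (v , _ , reg)) = v , reg

      to-cong : ∀ x y → x A.≈ y → to x U.≈ to y
      to-cong (v , _) (w , _) v≈w with zero⊎unit (v zero) | zero⊎unit (w zero)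
      ... | inj₁ _    | inj₁ _    = Sum.inj₁ (v≈w ∘ suc)
      ... | inj₂ _    | inj₂ _    = Sum.inj₂ v≈w
      -- Equal vectors never land in different summands, as a unit is not zero.
      ... | inj₁ v₀≈0 | inj₂ u    = contradiction (trans (sym (v≈w zero)) v₀≈0) (unit⇒≉0 u)
      ... | inj₂ u    | inj₁ w₀≈0 = contradiction (trans (v≈w zero) w₀≈0) (unit⇒≉0 u)

      from-cong : ∀ x y → x U.≈ y → from x A.≈ from y
      from-cong _ _ (Sum.inj₁ v≈w) = λ { zero → refl ; (suc i) → v≈w i }
      from-cong _ _ (Sum.inj₂ v≈w) = v≈w

      to∘from : ∀ x → to (from x) U.≈ x
      to∘from (inj₁ (v , _)) with zero⊎unit 0#
      ... | inj₁ _ = Sum.inj₁ (λ _ → refl)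
      ... | inj₂ u = contradiction refl (unit⇒≉0 u)
      to∘from (inj₂ (v , u , _)) with zero⊎unit (v zero)
      ... | inj₁ v₀≈0 = contradiction v₀≈0 (unit⇒≉0 u)
      ... | inj₂ _    = Sum.inj₂ (λ _ → refl)

      from∘to : ∀ x → from (to x) A.≈ x
      from∘to (v , _) with zero⊎unit (v zero)
      ... | inj₁ v₀≈0 = λ { zero → sym v₀≈0 ; (suc i) → refl }
      ... | inj₂ _    = λ _ → refl

    module _ {n : ℕ} where

      -- The coefficients of 1/v modulo X^(n+1), which are all that `Regular (suc n)` sees.
      inverseVector : (v : Vector Carrier (suc n)) → Unit (v zero) → Vector Carrier (suc n)
      inverseVector v u i = reciprocal (v ▹ 𝟘) u (toℕ i)

      inverseVector-inverseMod : ∀ v u → InverseMod (suc n) (v ▹ 𝟘) (inverseVector v u ▹ 𝟘)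
      inverseVector-inverseMod v u = inverseMod-sym {f = inverseVector v u ▹ 𝟘}
        (inverseMod-cong {f = reciprocal (v ▹ 𝟘) u} {g = v ▹ 𝟘}
          (λ i i<n → reflexive (≡.sym (restrict-▹ (reciprocal (v ▹ 𝟘) u) 𝟘 i i<n)))
          (inverseMod-sym {f = v ▹ 𝟘} (reciprocal-inverseMod (v ▹ 𝟘) u (suc n))))

      ▹-injective : ∀ {v w : Vector Carrier (suc n)} → (∀ i → i < suc n → (v ▹ 𝟘) i ≈ (w ▹ 𝟘) i) →
                    ∀ i → v i ≈ w i
      ▹-injective {v} {w} v≈w i = trans (reflexive (≡.sym (▹-toℕ v 𝟘 i)))
        (trans (v≈w (toℕ i) (toℕ<n i)) (reflexive (▹-toℕ w 𝟘 i)))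

      -- The construction uses the chosen inverse of the head, and `u` and `t` may be unrelated;
      -- uniqueness of inverses modulo X^(n+1) makes the results agree.
      inverseVector-cong : ∀ v u w t → (∀ i → v i ≈ w i) → ∀ i → inverseVector v u i ≈ inverseVector w t i
      inverseVector-cong v u w t v≈w = ▹-injective (inverseMod-unique {g = v ▹ 𝟘}
        (inverseMod-sym {f = v ▹ 𝟘} (inverseVector-inverseMod v u))
        (inverseMod-cong {f = w ▹ 𝟘} {g = inverseVector w t ▹ 𝟘} (▹-cong 𝟘 𝟘 (sym ∘ v≈w))
          (inverseVector-inverseMod w t)))

      inverseVector-involutive : ∀ v u t → ∀ i → inverseVector (inverseVector v u) t i ≈ v i
      inverseVector-involutive v u t = ▹-injective (inverseMod-unique {g = inverseVector v u ▹ 𝟘}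
        (inverseMod-sym {f = inverseVector v u ▹ 𝟘} (inverseVector-inverseMod (inverseVector v u) t))
        (inverseMod-sym {f = v ▹ 𝟘} (inverseVector-inverseMod v u)))

    unitRegular-inverse : ∀ {n a b} → a ≤ suc n → b ≤ suc n →
                          Inverse (unitRegularSetoid n a b) (unitRegularSetoid n b a)
    unitRegular-inverse {n} {a} {b} a≤n b≤n = mkInverse (unitRegularSetoid n a b) (unitRegularSetoid n b a)
      (invert b≤n) (invert a≤n)
      (λ (v , u , _) (w , t , _) → inverseVector-cong v u w t)
      (λ (v , u , _) (w , t , _) → inverseVector-cong v u w t)
      (λ (v , u , _) → inverseVector-involutive v u (reciprocal-unit (v ▹ 𝟘) u))
      (λ (v , u , _) → inverseVector-involutive v u (reciprocal-unit (v ▹ 𝟘) u))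
      where
      invert : ∀ {a b} → b ≤ suc n → Setoid.Carrier (unitRegularSetoid n a b) →
               Setoid.Carrier (unitRegularSetoid n b a)
      invert b≤n (v , u , reg) = inverseVector v u , reciprocal-unit (v ▹ 𝟘) u ,
        regular-inverse {f = v ▹ 𝟘} (inverseVector-inverseMod v u) b≤n reg

    unitRegular-∷ : ∀ {n a b} → a ≤ suc b →
                    Inverse (unitRegularSetoid n a (suc b)) (×-setoid unitSetoid (regularSetoid n a b))
    unitRegular-∷ {n} {a} {b} a≤1+b = mkInverse
      (unitRegularSetoid n a (suc b)) (×-setoid unitSetoid (regularSetoid n a b))
      (λ (v , u , reg) → (v zero , u) , v ∘ suc , Equivalence.to (regular-shiftDown (inj₂ a≤1+b)) reg)
      (λ ((x , u) , v , reg) →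
        x ∷ v , u , Equivalence.from (regular-shiftDown {f = (x ∷ v) ▹ 𝟘} (inj₂ a≤1+b)) reg)
      (λ _ _ v≈w → v≈w zero , v≈w ∘ suc)
      (λ _ _ (x≈y , v≈w) → λ { zero → x≈y ; (suc i) → v≈w i })
      (λ _ → refl , λ _ → refl)
      (λ _ → λ { zero → refl ; (suc i) → refl })

    -- Inversion exchanges `suc a` and `b`. Since `b ≤ a`, regularity then ignores the constant
    -- term, which only has to be one of the `q` units.
    cardinality-unitRegular : ∀ {n a b k} → b ≤ a → suc a ≤ suc n → b ≤ suc n →
                              HasCardinality (regularSetoid n b a) k →
                              HasCardinality (unitRegularSetoid n (suc a) b) (q * k)
    cardinality-unitRegular b≤a a<n b≤n |reg| = cardinality-↔ (unitRegular-inverse a<n b≤n)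
      (cardinality-↔ (unitRegular-∷ (ℕ.m≤n⇒m≤1+n b≤a)) (cardinality-× cardinality-unit |reg|))

    -- Each recursive call drops one coefficient, and `a + b ≡ n` keeps the systems square.
    cardinality-regular : ∀ n a b → a + b ≡ n → HasCardinality (regularSetoid n a b) (regularCount q n a)
    cardinality-regular zero zero zero _ = mkInverse (regularSetoid 0 0 0) (≡.setoid (Fin 1))
      (λ _ → zero) (λ _ → (λ ()) , regular-zero 0 _ 0)
      (λ _ _ _ → ≡.refl) (λ _ _ _ ()) (λ { zero → ≡.refl }) (λ _ ())
    cardinality-regular (suc n) (suc a) zero eq
      with ≡.refl ← ≡.trans (≡.sym (ℕ.+-identityʳ a)) (ℕ.suc-injective eq) =
      -- After inversion the degree bound is 0 and the condition is void: a unit constant term and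
      -- `n` free coefficients remain.
      cardinality-≡ (ℕ.*-comm q (suc q ^ n)) (cardinality-↔ regular-full
        (cardinality-unitRegular z≤n ℕ.≤-refl z≤n (cardinality-regular n 0 n ≡.refl)))
    cardinality-regular (suc n) a (suc b) eq with a ≤? suc b
    ... | yes a≤1+b = cardinality-≡ (regularCount-suc q n a (≡.subst (a ≤_) a+b≡n (ℕ.m≤m+n a b)))
      (cardinality-↔ (regular-∷ a≤1+b) (cardinality-× |R| (cardinality-regular n a b a+b≡n)))
      where
      a+b≡n : a + b ≡ n
      a+b≡n = ℕ.suc-injective (≡.trans (≡.sym (ℕ.+-suc a b)) eq)
    cardinality-regular (suc (suc n)) (suc a) (suc b) eq | no a≰b =
      -- Both branches involve the same number `suc q ^ n * q`, once plain and once times `q`. Their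
      -- sum is `suc q` times it by definition, which leaves associativity.
      cardinality-≡ (≡.sym (ℕ.*-assoc (suc q) (suc q ^ n) q)) (cardinality-↔ regular-split (cardinality-⊎
        (cardinality-regular (suc n) (suc a) b (≡.trans (≡.sym (ℕ.+-suc a b)) a+1+b≡1+n))
        (cardinality-unitRegular (s≤s⁻¹ (≰⇒> a≰b))
          (≡.subst (suc a ≤_) eq (ℕ.m≤m+n (suc a) (suc b)))
          (≡.subst (suc b ≤_) eq (ℕ.m≤n+m (suc b) (suc a)))
          (cardinality-regular (suc n) (suc b) a (≡.trans (ℕ.+-comm (suc b) a) a+1+b≡1+n)))))
      where
      a+1+b≡1+n : a + suc b ≡ suc n
      a+1+b≡1+n = ℕ.suc-injective eq
    cardinality-regular (suc zero) (suc a) (suc b) eq | no _ =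
      contradiction (≡.trans (≡.sym (ℕ.+-suc a b)) (ℕ.suc-injective eq)) ℕ.1+n≢0
    cardinality-regular (suc n) zero (suc b) eq | no a≰b = contradiction z≤n a≰b

-- Linear cellular automata as multiplication of power series

-- Reversing a concatenation reverses the order of the blocks and each block in itself.
position-from-end : ∀ k b (j : Fin (suc k)) (c : Fin b) →
                    suc k * b ∸ suc (toℕ (combine j c)) ≡ (k ∸ toℕ j) * b + toℕ (opposite c)
position-from-end k b j c = begin
  suc k * b ∸ suc (toℕ (combine j c))
    -- Writing `k` as `toℕ j + m`, and then `b` as `suc (toℕ c) + r`, exposes the subtrahend as a
    -- summand of the product.
    ≡⟨ ≡.cong₂ (λ x y → suc x * b ∸ suc y) (≡.sym (ℕ.m+[n∸m]≡n (toℕ≤pred[n] j))) (toℕ-combine j c) ⟩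
  suc (toℕ j + m) * b ∸ suc (b * toℕ j + toℕ c)
    ≡⟨ ≡.cong (λ x → suc (toℕ j + m) * x ∸ suc (x * toℕ j + toℕ c)) (≡.sym (ℕ.m+[n∸m]≡n (toℕ<n c))) ⟩
  suc (toℕ j + m) * (suc (toℕ c) + r) ∸ suc ((suc (toℕ c) + r) * toℕ j + toℕ c)
    ≡⟨ ≡.cong (_∸ suc ((suc (toℕ c) + r) * toℕ j + toℕ c)) (identity (toℕ j) m (toℕ c) r) ⟩
  suc ((suc (toℕ c) + r) * toℕ j + toℕ c) + (m * (suc (toℕ c) + r) + r)
    ∸ suc ((suc (toℕ c) + r) * toℕ j + toℕ c)
    ≡⟨ ℕ.m+n∸m≡n (suc ((suc (toℕ c) + r) * toℕ j + toℕ c)) _ ⟩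
  m * (suc (toℕ c) + r) + r
    ≡⟨ ≡.cong₂ (λ x y → m * x + y) (ℕ.m+[n∸m]≡n (toℕ<n c)) (≡.sym (opposite-prop c)) ⟩
  m * b + toℕ (opposite c) ∎
  where
  open ≡.≡-Reasoning
  m r : ℕ
  m = k ∸ toℕ j
  r = b ∸ suc (toℕ c)
  identity : ∀ j m c r → suc (j + m) * (suc c + r) ≡ suc ((suc c + r) * j + c) + (m * (suc c + r) + r)
  identity = solve-∀

-- Splits off the offset `(k ∸ toℕ j) * b` of block `j` in the reversed input, which `⊛-shiftUp`
-- then cancels.
output-position : ∀ k b (j : Fin (suc k)) (i : Fin b) →
                  b + k * b ∸ suc (toℕ i) ≡ (k ∸ toℕ j) * b + (toℕ j * b + toℕ (opposite i))
output-position k b j i = begin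
  b + k * b ∸ suc (toℕ i)
    ≡⟨ ≡.cong (_∸ suc (toℕ i)) (ℕ.+-comm b (k * b)) ⟩
  k * b + b ∸ suc (toℕ i)
    ≡⟨ ℕ.+-∸-assoc (k * b) (toℕ<n i) ⟩
  k * b + (b ∸ suc (toℕ i))
    ≡⟨ ≡.cong₂ (λ x y → x * b + y) (≡.sym (ℕ.m∸n+n≡m (toℕ≤pred[n] j))) (≡.sym (opposite-prop i)) ⟩
  (k ∸ toℕ j + toℕ j) * b + toℕ (opposite i)
    ≡⟨ ≡.cong (_+ toℕ (opposite i)) (ℕ.*-distribʳ-+ b (k ∸ toℕ j) (toℕ j)) ⟩
  (k ∸ toℕ j) * b + toℕ j * b + toℕ (opposite i)
    ≡⟨ ℕ.+-assoc ((k ∸ toℕ j) * b) _ _ ⟩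
  (k ∸ toℕ j) * b + (toℕ j * b + toℕ (opposite i)) ∎
  where open ≡.≡-Reasoning

module LinearAutomata {c ℓ} (R : CommutativeRing c ℓ) where

  open CommutativeRing R hiding (zero) renaming (_*_ to _·_; _+_ to _⊹_)
  open Series R
  open RawMonoidDefinitions +-rawMonoid using (sum)
  open CommutativeMonoidSum +-commutativeMonoid using (sum-cong-≋; ∑-distrib-+; sum-replicate-zero)
  open import Relation.Binary.Reasoning.Setoid setoid

  -- For `e ≤ n` the subtraction never truncates, and the coefficients of `a ▹ 𝟘` beyond `e`
  -- contribute nothing.
  sum-⊛ : ∀ {e} (a : Vector Carrier (suc e)) s n → e ≤ n →
          sum (λ j → a j · s (n ∸ toℕ j)) ≈ ((a ▹ 𝟘) ⊛ s) n
  sum-⊛ {zero}  a s zero    _         = +-identityʳ _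
  sum-⊛ {zero}  a s (suc n) _         = +-congˡ (sym (⊛-zeroˡ s n λ _ _ → refl))
  sum-⊛ {suc e} a s (suc n) (s≤s e≤n) = +-congˡ (sum-⊛ (a ∘ suc) s n e≤n)

  linearRule : ∀ {n} → Vector Carrier n → Vector Carrier n → Carrier
  linearRule a x = sum (λ j → a j · x j)

  linearCA : ∀ m e → Vector Carrier (suc e) → Vector Carrier (m + e) → Vector Carrier m
  linearCA m e a = cellularAutomaton m e (linearRule a)

  toℕ-windowIndex : ∀ {m e} (i : Fin m) (j : Fin (suc e)) → toℕ (windowIndex i j) ≡ toℕ i + toℕ j
  toℕ-windowIndex i j = toℕ-fromℕ< _

  linearCA-cong : ∀ m e {a a′} {x x′} → (∀ j → a j ≈ a′ j) → (∀ t → x t ≈ x′ t) →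
                  ∀ i → linearCA m e a x i ≈ linearCA m e a′ x′ i
  linearCA-cong m e {a} a≈ x≈ i = sum-cong-≋ (λ j → *-cong (a≈ j) (x≈ (windowIndex i j)))

  linearCA-+ : ∀ m e a x y i → linearCA m e a (λ t → x t ⊹ y t) i ≈ linearCA m e a x i ⊹ linearCA m e a y i
  linearCA-+ m e a x y i = trans
    (sum-cong-≋ (λ j → distribˡ (a j) (x (windowIndex i j)) (y (windowIndex i j))))
    (∑-distrib-+ (λ j → a j · x (windowIndex i j)) (λ j → a j · y (windowIndex i j)))

  -- Moving right in a window lowers the index in the reversed input, so the correlation with `a`
  -- becomes a convolution. Each window lies inside the input, which gives the bound for `sum-⊛`.
  linearCA-⊛ : ∀ m e a x s → (∀ t → x t ≈ s (m + e ∸ suc (toℕ t))) →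
               ∀ i → linearCA m e a x i ≈ ((a ▹ 𝟘) ⊛ s) (m + e ∸ suc (toℕ i))
  linearCA-⊛ m e a x s x≈s i = trans
    (sum-cong-≋ (λ j → *-congˡ {a j} (trans (x≈s (windowIndex i j)) (reflexive (≡.cong s (index j))))))
    (sum-⊛ a s (m + e ∸ suc (toℕ i))
      (ℕ.m+n≤o⇒m≤o∸n e (≡.subst (e + suc (toℕ i) ≤_) (ℕ.+-comm e m) (ℕ.+-monoʳ-≤ e (toℕ<n i)))))
    where
    index : ∀ j → m + e ∸ suc (toℕ (windowIndex i j)) ≡ m + e ∸ suc (toℕ i) ∸ toℕ j
    index j = ≡.trans (≡.cong (λ x → m + e ∸ suc x) (toℕ-windowIndex i j))
                      (≡.sym (ℕ.∸-+-assoc (m + e) (suc (toℕ i)) (toℕ j)))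

  sum-basis : ∀ {n} (a : Vector Carrier n) j → sum (λ i → a i · shiftUp (toℕ j) 𝟙 (toℕ i)) ≈ a j
  sum-basis {suc n} a zero    = trans
    (+-cong (*-identityʳ _) (trans (sum-cong-≋ (λ i → zeroʳ (a (suc i)))) (sum-replicate-zero n)))
    (+-identityʳ _)
  sum-basis a (suc j) = trans (+-cong (zeroʳ _) (sum-basis (a ∘ suc) j)) (+-identityˡ _)

  -- The first output cell on the `j`-th basis vector, which for a linear rule is its `j`-th
  -- coefficient.
  coefficient : ∀ m e → (Vector Carrier (suc m + e) → Vector Carrier (suc m)) → Vector Carrier (suc e)
  coefficient m e F j = F (λ t → shiftUp (toℕ j) 𝟙 (toℕ t)) zero

  coefficient-linearCA : ∀ m e a j → coefficient m e (linearCA (suc m) e a) j ≈ a j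
  coefficient-linearCA m e a j = trans
    (sum-cong-≋ λ i → *-congˡ {a i} (reflexive (≡.cong (shiftUp (toℕ j) 𝟙) (toℕ-windowIndex {suc m} zero i))))
    (sum-basis a j)

  module _ {k b : ℕ} where

    -- The decision is an argument so that proofs can match on it directly.
    blockRow : {j j′ : Fin (suc k)} → Dec (j ≡ j′) → Vector Carrier b → Vector Carrier b
    blockRow (yes _) d = d
    blockRow (no  _) d = λ _ → 0#

    block : Fin (suc k) → Vector Carrier b → Vector Carrier (suc k * b)
    block j d = concat (λ j′ → blockRow (j Fin.≟ j′) d)

    reverseSeries : Vector Carrier b → Series
    reverseSeries d = (d ∘ opposite) ▹ 𝟘

    reverseSeries-opposite : ∀ d c → reverseSeries d (toℕ (opposite c)) ≡ d c
    reverseSeries-opposite d c = ≡.trans (▹-toℕ (d ∘ opposite) 𝟘 (opposite c)) (≡.cong d (opposite-involutive c))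

    -- In the reversed input, `k ∸ toℕ j` blocks precede block `j`. Blocks with larger index fall
    -- below the shift, and those with smaller index beyond the `b` coefficients of `d`.
    block-series : ∀ j d t → block j d t ≈ shiftUp ((k ∸ toℕ j) * b) (reverseSeries d) (suc k * b ∸ suc (toℕ t))
    block-series j d t = trans
      (row (proj₁ (remQuot {suc k} b t)) (proj₂ (remQuot {suc k} b t)) (j Fin.≟ proj₁ (remQuot {suc k} b t)))
      (reflexive (≡.cong (shiftUp (m * b) (reverseSeries d)) (≡.trans
        (≡.sym (position-from-end k b (proj₁ (remQuot {suc k} b t)) (proj₂ (remQuot {suc k} b t))))
        (≡.cong (λ t → suc k * b ∸ suc (toℕ t)) (combine-remQuot {suc k} b t)))))
      where
      m : ℕ
      m = k ∸ toℕ j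

      row : ∀ j′ c (j≟j′ : Dec (j ≡ j′)) → blockRow j≟j′ d c ≈
            shiftUp (m * b) (reverseSeries d) ((k ∸ toℕ j′) * b + toℕ (opposite c))
      row j′ c (yes ≡.refl) = reflexive (≡.sym (≡.trans (shiftUp-+ (m * b) _ _) (reverseSeries-opposite d c)))
      row j′ c (no j≢j′) with <-cmp (toℕ j) (toℕ j′)
      ... | tri≈ _ j≡j′ _ = contradiction (Fin.toℕ-injective j≡j′) j≢j′
      ... | tri< j<j′ _ _ = reflexive (≡.sym (shiftUp-< (m * b) _ (ℕ.<-≤-trans
              (≡.subst (_< b + (k ∸ toℕ j′) * b) (ℕ.+-comm (toℕ (opposite c)) _)
                (ℕ.+-monoˡ-< ((k ∸ toℕ j′) * b) (toℕ<n (opposite c))))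
              (ℕ.*-monoˡ-≤ b (ℕ.∸-monoʳ-< j<j′ (toℕ≤pred[n] j′))))))
      ... | tri> _ _ j′<j with o , eq ← ℕ.m≤n⇒∃[o]m+o≡n (ℕ.∸-monoʳ-< j′<j (toℕ≤pred[n] j)) = sym (begin
        shiftUp (m * b) (reverseSeries d) ((k ∸ toℕ j′) * b + r)
          ≡⟨ ≡.cong (λ x → shiftUp (m * b) (reverseSeries d) (x * b + r)) eq ⟨
        shiftUp (m * b) (reverseSeries d) ((suc m + o) * b + r)
          ≡⟨ ≡.cong (shiftUp (m * b) (reverseSeries d)) (identity m o b r) ⟩
        shiftUp (m * b) (reverseSeries d) (m * b + (b + (o * b + r)))
          ≡⟨ shiftUp-+ (m * b) _ _ ⟩
        reverseSeries d (b + (o * b + r))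
          ≡⟨ ▹-+ b (d ∘ opposite) 𝟘 _ ⟩
        0# ∎)
        where
        r : ℕ
        r = toℕ (opposite c)
        identity : ∀ m o b r → (suc m + o) * b + r ≡ m * b + (b + (o * b + r))
        identity = solve-∀

    linearCA-block : ∀ a j d i → linearCA b (k * b) a (block j d) i ≈
                     ((a ▹ 𝟘) ⊛ reverseSeries d) (toℕ j * b + toℕ (opposite i))
    linearCA-block a j d i = begin
      linearCA b (k * b) a (block j d) i
        ≈⟨ linearCA-⊛ b (k * b) a (block j d) _ (block-series j d) i ⟩
      ((a ▹ 𝟘) ⊛ s) (b + k * b ∸ suc (toℕ i))
        ≡⟨ ≡.cong ((a ▹ 𝟘) ⊛ s) (output-position k b j i) ⟩
      ((a ▹ 𝟘) ⊛ s) ((k ∸ toℕ j) * b + (toℕ j * b + toℕ (opposite i)))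
        ≈⟨ ⊛-shiftUp ((k ∸ toℕ j) * b) (a ▹ 𝟘) (reverseSeries d) _ ⟩
      ((a ▹ 𝟘) ⊛ reverseSeries d) (toℕ j * b + toℕ (opposite i)) ∎
      where
      s : Series
      s = shiftUp ((k ∸ toℕ j) * b) (reverseSeries d)

    BlockInjective : Vector Carrier (suc (k * b)) → Fin (suc k) → Set _
    BlockInjective a j = ∀ d → (∀ i → linearCA b (k * b) a (block j d) i ≈ 0#) → ∀ c → d c ≈ 0#

    -- By `linearCA-block` the outputs are the coefficients j b, ..., (j+1) b - 1 of a product, and
    -- reversal matches vectors `d` with polynomials of degree below `b`.
    blockInjective⇔regular : ∀ a j → BlockInjective a j ⇔ Regular (suc (toℕ j) * b) (a ▹ 𝟘) b (toℕ j * b)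
    blockInjective⇔regular a j = mk⇔ to from
      where
      to : BlockInjective a j → Regular (suc (toℕ j) * b) (a ▹ 𝟘) b (toℕ j * b)
      to inj w w< aw≈0 n with n ℕ.<? b
      ... | no  n≮b = w< n (ℕ.≮⇒≥ n≮b)
      ... | yes n<b = begin
        w n                                     ≡⟨ ≡.cong w (toℕ-fromℕ< n<b) ⟨
        w (toℕ (fromℕ< n<b))                    ≡⟨ ≡.cong (w ∘ toℕ) (opposite-involutive (fromℕ< n<b)) ⟨
        d (opposite (fromℕ< n<b))               ≈⟨ inj d d-kernel (opposite (fromℕ< n<b)) ⟩
        0# ∎
        where
        d : Vector Carrier b
        d c = w (toℕ (opposite c))

        d≈w : ∀ i → reverseSeries d i ≈ w i
        d≈w i with i ℕ.<? b
        ... | no  i≮b = trans (▹-<deg (d ∘ opposite) i (ℕ.≮⇒≥ i≮b)) (sym (w< i (ℕ.≮⇒≥ i≮b)))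
        ... | yes i<b = trans
          (▹-cong 𝟘 𝟘 (λ c → reflexive (≡.cong (w ∘ toℕ) (opposite-involutive c))) i i<b)
          (reflexive (restrict-▹ w 𝟘 i i<b))

        d-kernel : ∀ i → linearCA b (k * b) a (block j d) i ≈ 0#
        d-kernel i = trans (linearCA-block a j d i) (trans
          (⊛-cong {a ▹ 𝟘} (toℕ j * b + toℕ (opposite i)) (λ _ _ → refl) (λ i _ → d≈w i))
          (aw≈0 _ (ℕ.m≤m+n (toℕ j * b) _) (≡.subst (toℕ j * b + toℕ (opposite i) <_) (ℕ.+-comm (toℕ j * b) b)
             (ℕ.+-monoʳ-< (toℕ j * b) (toℕ<n (opposite i))))))

      from : Regular (suc (toℕ j) * b) (a ▹ 𝟘) b (toℕ j * b) → BlockInjective a j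
      from reg d ad≈0 c = trans (reflexive (≡.sym (reverseSeries-opposite d c)))
        (reg (reverseSeries d) (▹-<deg (d ∘ opposite)) kernel (toℕ (opposite c)))
        where
        kernel : ∀ n → toℕ j * b ≤ n → n < suc (toℕ j) * b → ((a ▹ 𝟘) ⊛ reverseSeries d) n ≈ 0#
        kernel n jb≤n n<jb+b with r , ≡.refl ← ℕ.m≤n⇒∃[o]m+o≡n jb≤n = begin
          ((a ▹ 𝟘) ⊛ reverseSeries d) (toℕ j * b + r)
            ≡⟨ ≡.cong (λ r → ((a ▹ 𝟘) ⊛ reverseSeries d) (toℕ j * b + r))
                 (≡.trans (≡.cong toℕ (opposite-involutive (fromℕ< r<b))) (toℕ-fromℕ< r<b)) ⟨
          ((a ▹ 𝟘) ⊛ reverseSeries d) (toℕ j * b + toℕ (opposite (opposite (fromℕ< r<b))))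
            ≈⟨ linearCA-block a j d (opposite (fromℕ< r<b)) ⟨
          linearCA b (k * b) a (block j d) (opposite (fromℕ< r<b))
            ≈⟨ ad≈0 (opposite (fromℕ< r<b)) ⟩
          0# ∎
          where
          r<b : r < b
          r<b = ℕ.+-cancelˡ-< (toℕ j * b) r b (≡.subst (toℕ j * b + r <_) (ℕ.+-comm b (toℕ j * b)) n<jb+b)

-- Latin cubes

-- Pigeonhole: punching out a missed value would inject `Fin (suc n)` into `Fin n`.
injective⇒bijective : ∀ {n} {f : Fin n → Fin n} → Injective _≡_ _≡_ f → Bijective _≡_ _≡_ f
injective⇒bijective {suc n} {f} inj = inj , λ y → surjective y (any? (λ x → f x Fin.≟ y))
  where
  surjective : ∀ y → Dec (∃ λ x → f x ≡ y) → ∃ λ x → ∀ {z} → z ≡ x → f z ≡ y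
  surjective y (yes (x , fx≡y)) = x , λ { ≡.refl → fx≡y }
  surjective y (no  ∄x)         = contradiction
    (injective⇒≤ {f = λ x → punchOut (y≢f x)} (λ {x} {x′} eq → inj (punchOut-injective (y≢f x) (y≢f x′) eq)))
    ℕ.1+n≰n
    where
    y≢f : ∀ x → y ≢ f x
    y≢f x y≡fx = ∄x (x , ≡.sym y≡fx)
injective⇒bijective {zero} inj = inj , λ ()

-- Units of a finite Heyting field

module HeytingFieldProperties {c ℓ₁ ℓ₂} (K : HeytingField c ℓ₁ ℓ₂) where

  open HeytingField K using (heytingCommutativeRing; _#_; tight; #⇒invertible; invertible⇒#; #-irrefl)

  commutativeRing : CommutativeRing c ℓ₁
  commutativeRing = HeytingCommutativeRing.commutativeRing heytingCommutativeRing

  open CommutativeRing commutativeRing hiding (zero) renaming (_*_ to _·_; _+_ to _⊹_)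
  open RingProperties ring using (-0#≈0#)
  open Series commutativeRing using (Unit)

  x-0≈x : ∀ x → x - 0# ≈ x
  x-0≈x x = trans (+-congˡ -0#≈0#) (+-identityʳ x)

  -- The difference `1# - 0#` is invertible, so `1#` is apart from `0#`, and apartness is
  -- irreflexive.
  1≉0 : 1# ≉ 0#
  1≉0 1≈0 = #-irrefl 1≈0 (invertible⇒# (1# , 1·[1-0]≈1 , trans (*-comm _ _) 1·[1-0]≈1))
    where
    1·[1-0]≈1 : 1# · (1# - 0#) ≈ 1#
    1·[1-0]≈1 = trans (*-identityˡ _) (x-0≈x 1#)

  -- Tightness only yields ¬ ¬ (x # 0#) for nonzero x; finiteness replaces this
  -- by a search for the inverse.
  zero⊎unit : ∀ {q} → HasCardinality setoid q → ∀ x → x ≈ 0# ⊎ Unit x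
  zero⊎unit |K| x with any? (λ i → map′ from-≡ |K|.to-cong (|K|.to (|K|.from i · x) Fin.≟ |K|.to 1#))
    where
    module |K| = Inverse |K|
    from-≡ : ∀ {y z} → |K|.to y ≡ |K|.to z → y ≈ z
    from-≡ {y} {z} eq = trans (sym (|K|.strictlyInverseʳ y))
      (trans (reflexive (≡.cong |K|.from eq)) (|K|.strictlyInverseʳ z))
  ... | yes (i , yx≈1) = inj₂ (Inverse.from |K| i , yx≈1)
  ... | no  ∄y         = inj₁ (proj₁ (tight x 0#) λ x#0 →
    let y , y[x-0]≈1 , _ = #⇒invertible x#0
    in ∄y (Inverse.to |K| y , trans (*-congʳ (Inverse.strictlyInverseʳ |K| y))
                                    (trans (*-congˡ (sym (x-0≈x x))) y[x-0]≈1)))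

-- Latin lines as regular Toeplitz systems

module LatinCubes {c ℓ₁ ℓ₂} (K : HeytingField c ℓ₁ ℓ₂) where

  open HeytingFieldProperties K
  open CommutativeRing commutativeRing hiding (zero) renaming (_*_ to _·_; _+_ to _⊹_)
  open Series commutativeRing
  open LinearAutomata commutativeRing
  open FiniteField commutativeRing using (regularSetoid)
  open GroupProperties +-group using (identityʳ-unique)
  open AbelianGroupProperties +-abelianGroup using (xyx⁻¹≈y)
  open RingProperties ring using (x∙y⁻¹≈ε⇒x≈y)
  open import Relation.Binary.Reasoning.Setoid setoid

  ▹-snoc : ∀ {n} {v : Vector Carrier n} (w : Vector Carrier (suc n)) s →
           (∀ i → v i ≈ w (inject₁ i)) → s 0 ≈ w (fromℕ n) → ∀ j → (v ▹ s) (toℕ j) ≈ w j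
  ▹-snoc {zero}  w s v≈w s₀≈w zero    = s₀≈w
  ▹-snoc {suc n} w s v≈w s₀≈w zero    = v≈w zero
  ▹-snoc {suc n} w s v≈w s₀≈w (suc j) = ▹-snoc (w ∘ suc) s (v≈w ∘ suc) s₀≈w j

  ▹-init : ∀ {n} (w : Vector Carrier (suc n)) s t k → k < n → (w ▹ s) k ≡ ((w ∘ inject₁) ▹ t) k
  ▹-init w s t zero    (s≤s _)   = ≡.refl
  ▹-init w s t (suc k) (s≤s k<n) = ▹-init (w ∘ suc) s t k k<n

  -- For the first direction: inversion carries the void system of degree bound 0 for 1/f to this
  -- one.
  regular-invertible : ∀ f b → Unit (f 0) → Regular b f b 0
  regular-invertible f b u = regular-inverse {f = reciprocal f u}
    (inverseMod-sym {f = f} (reciprocal-inverseMod f u b)) ℕ.≤-refl (regular-zero b (reciprocal f u) b)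

  -- For the last direction: the top coefficient of `w` reappears in the product at a position
  -- required to vanish, so the degree bound of `w` descends to 0.
  regular-monic : ∀ f b e → f <deg suc e → f e ≈ 1# → Regular (b + e) f b e
  regular-monic f b e f< fe≈1 w w< fw≈0 = vanish b ℕ.≤-refl w<
    where
    vanish : ∀ m → m ≤ b → w <deg m → ∀ i → w i ≈ 0#
    vanish zero    _   w<     i = w< i z≤n
    vanish (suc m) m<b w<1+m = vanish m (ℕ.<⇒≤ m<b) w<m
      where
      wm≈0 : w m ≈ 0#
      wm≈0 = begin
        w m             ≈⟨ *-identityˡ _ ⟨
        1# · w m        ≈⟨ *-congʳ fe≈1 ⟨
        f e · w m       ≈⟨ ⊛-leading e m f< w<1+m ⟨
        (f ⊛ w) (e + m) ≈⟨ fw≈0 (e + m) (ℕ.m≤m+n e m) (≡.subst (e + m <_) (ℕ.+-comm e b) (ℕ.+-monoʳ-< e m<b)) ⟩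
        0# ∎

      w<m : w <deg m
      w<m i m≤i with m≤n⇒m<n∨m≡n m≤i
      ... | inj₁ m<i    = w<1+m i m<i
      ... | inj₂ ≡.refl = wm≈0

  module _ {ℓ₃ b N k} {_⊑_ : Rel (Vector Carrier b) ℓ₃} (Ψ : MonotoneBijection K b N _⊑_)
           (a : Vector Carrier (suc (k * b)))
           {F : Vector Carrier (suc k * b) → Vector Carrier b}
           (F-linear : ∀ x i → F x i ≈ linearCA b (k * b) a x i) where

    private
      module Ψ = MonotoneBijection Ψ
      module Ψ↔ = Inverse Ψ.inverse

      input : Vec (Fin N) (suc k) → Vector Carrier (suc k * b)
      input i = concat (λ j → Ψ.to (lookup i j))

      to-injective : ∀ {t t′} → (∀ c → Ψ.to t c ≈ Ψ.to t′ c) → t ≡ t′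
      to-injective {t} {t′} eq =
        ≡.trans (≡.sym (Ψ↔.strictlyInverseʳ t)) (≡.trans (Ψ↔.from-cong eq) (Ψ↔.strictlyInverseʳ t′))

      from-injective : ∀ {x y} → Ψ.from x ≡ Ψ.from y → ∀ c → x c ≈ y c
      from-injective {x} {y} eq c = trans (sym (Ψ↔.strictlyInverseˡ x c))
        (trans (reflexive (≡.cong (λ t → Ψ.to t c) eq)) (Ψ↔.strictlyInverseˡ y c))

      input-update : ∀ j i t t′ d → (∀ c → Ψ.to t c ≈ Ψ.to t′ c ⊹ d c) →
                     ∀ n → input (i [ j ]≔ t) n ≈ input (i [ j ]≔ t′) n ⊹ block j d n
      input-update j i t t′ d t≈t′+d n =
        row (proj₁ (remQuot {suc k} b n)) (proj₂ (remQuot {suc k} b n)) (j Fin.≟ proj₁ (remQuot {suc k} b n))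
        where
        row : ∀ j′ c (j≟j′ : Dec (j ≡ j′)) →
              Ψ.to (lookup (i [ j ]≔ t) j′) c ≈ Ψ.to (lookup (i [ j ]≔ t′) j′) c ⊹ blockRow j≟j′ d c
        row j c (yes ≡.refl) = begin
          Ψ.to (lookup (i [ j ]≔ t) j) c ≡⟨ ≡.cong (λ t → Ψ.to t c) (lookup∘update j i t) ⟩
          Ψ.to t c                       ≈⟨ t≈t′+d c ⟩
          Ψ.to t′ c ⊹ d c                ≡⟨ ≡.cong (λ t → Ψ.to t c ⊹ d c) (lookup∘update j i t′) ⟨
          Ψ.to (lookup (i [ j ]≔ t′) j) c ⊹ d c ∎
        row j′ c (no j≢j′) = begin
          Ψ.to (lookup (i [ j ]≔ t) j′) c
            ≡⟨ ≡.cong (λ t → Ψ.to t c)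
                 (≡.trans (lookup∘update′ (j≢j′ ∘ ≡.sym) i t) (≡.sym (lookup∘update′ (j≢j′ ∘ ≡.sym) i t′))) ⟩
          Ψ.to (lookup (i [ j ]≔ t′) j′) c      ≈⟨ +-identityʳ _ ⟨
          Ψ.to (lookup (i [ j ]≔ t′) j′) c ⊹ 0# ∎

      -- Two cells on a line in direction `j` have inputs that differ in block `j` only. By
      -- linearity their outputs differ by the image of that block alone.
      F-update : ∀ j i t t′ d → (∀ c → Ψ.to t c ≈ Ψ.to t′ c ⊹ d c) → ∀ r →
                 F (input (i [ j ]≔ t)) r ≈ F (input (i [ j ]≔ t′)) r ⊹ linearCA b (k * b) a (block j d) r
      F-update j i t t′ d t≈t′+d r = begin
        F (input (i [ j ]≔ t)) r
          ≈⟨ F-linear _ r ⟩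
        linearCA b (k * b) a (input (i [ j ]≔ t)) r
          ≈⟨ linearCA-cong b (k * b) {a} {a} (λ _ → refl) (input-update j i t t′ d t≈t′+d) r ⟩
        linearCA b (k * b) a (λ n → input (i [ j ]≔ t′) n ⊹ block j d n) r
          ≈⟨ linearCA-+ b (k * b) a (input (i [ j ]≔ t′)) (block j d) r ⟩
        linearCA b (k * b) a (input (i [ j ]≔ t′)) r ⊹ linearCA b (k * b) a (block j d) r
          ≈⟨ +-congʳ (F-linear _ r) ⟨
        F (input (i [ j ]≔ t′)) r ⊹ linearCA b (k * b) a (block j d) r ∎

    -- A kernel vector `d` and the zero vector give the same entry on one line, here the one with
    -- all kept coordinates at the index of zero.
    latin⇒blockInjective : IsLatinHypercube (suc k) N (hypercube K {k = suc k} Ψ F) → ∀ j → BlockInjective a j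
    latin⇒blockInjective latin j d ad≈0 c = begin
      d c                            ≈⟨ Ψ↔.strictlyInverseˡ d c ⟨
      Ψ.to (Ψ.from d) c              ≡⟨ ≡.cong (λ t → Ψ.to t c) (proj₁ (latin j i) (Ψ↔.from-cong F≈)) ⟩
      Ψ.to (Ψ.from 𝟎) c              ≈⟨ Ψ↔.strictlyInverseˡ 𝟎 c ⟩
      0# ∎
      where
      𝟎 : Vector Carrier b
      𝟎 _ = 0#

      i : Vec (Fin N) (suc k)
      i = replicate (suc k) (Ψ.from 𝟎)

      F≈ : ∀ r → F (input (i [ j ]≔ Ψ.from d)) r ≈ F (input (i [ j ]≔ Ψ.from 𝟎)) r
      F≈ r = trans
        (F-update j i (Ψ.from d) (Ψ.from 𝟎) d (λ c → trans (Ψ↔.strictlyInverseˡ d c)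
          (sym (trans (+-congʳ (Ψ↔.strictlyInverseˡ 𝟎 c)) (+-identityˡ (d c))))) r)
        (trans (+-congˡ (ad≈0 r)) (+-identityʳ _))

    -- Equal entries on a line make the difference of the varied blocks a kernel vector; finiteness
    -- turns injectivity into bijectivity.
    blockInjective⇒latin : (∀ j → BlockInjective a j) → IsLatinHypercube (suc k) N (hypercube K {k = suc k} Ψ F)
    blockInjective⇒latin inj j i = injective⇒bijective λ {t} {t′} eq →
      to-injective λ c → x∙y⁻¹≈ε⇒x≈y (Ψ.to t c) (Ψ.to t′ c)
        (inj j (λ c → Ψ.to t c - Ψ.to t′ c) (λ r → identityʳ-unique (F (input (i [ j ]≔ t′)) r) _ (trans
          (sym (F-update j i t t′ _ (λ c → sym (trans (sym (+-assoc _ _ _)) (xyx⁻¹≈y _ _))) r))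
          (from-injective eq r))) c)

  -- Latin cubes and their 2b - 1 free coefficients

  module _ (m : ℕ) where

    private
      b = suc m
      -- This is 2b - 1, in the form for which `2 * b` computes to `suc n`.
      n = m + 1 * b

    -- The final 1 is the head of `𝟙`.
    extendCoefficients : Vector Carrier n → Vector Carrier (suc (2 * b))
    extendCoefficients v = 1# ∷ λ j → (v ▹ 𝟙) (toℕ j)

    extendCoefficients-last : ∀ v → extendCoefficients v (fromℕ (2 * b)) ≈ 1#
    extendCoefficients-last v = reflexive (≡.trans
      (≡.cong (v ▹ 𝟙) (≡.trans (toℕ-fromℕ n) (≡.sym (ℕ.+-identityʳ n)))) (▹-+ n v 𝟙 0))

    extendCoefficients-inner : ∀ v i → extendCoefficients v (suc (inject₁ i)) ≈ v i
    extendCoefficients-inner v i = reflexive (≡.trans (≡.cong (v ▹ 𝟙) (toℕ-inject₁ i)) (▹-toℕ v 𝟙 i))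

    extendCoefficients-inverse : ∀ {v} a → a zero ≈ 1# → a (fromℕ (2 * b)) ≈ 1# →
                                 (∀ i → v i ≈ a (suc (inject₁ i))) → ∀ j → extendCoefficients v j ≈ a j
    extendCoefficients-inverse a a₀≈1 aₑ≈1 v≈a zero    = sym a₀≈1
    extendCoefficients-inverse a a₀≈1 aₑ≈1 v≈a (suc j) = ▹-snoc (a ∘ suc) 𝟙 v≈a (sym aₑ≈1) j

    middle : Vector Carrier (suc (2 * b)) → Vector Carrier n
    middle a i = a (suc (inject₁ i))

    -- Rows b, ..., 2b - 1 never reach the last coefficient 2b, and `regular-shiftDown` removes the
    -- first, as the degree bound is `b`.
    middle-regular : ∀ a → BlockInjective {2} {b} a (suc zero) → Regular n (middle a ▹ 𝟘) (suc m) (m + 0)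
    middle-regular a inj = regular-cong
      (λ k k<n → reflexive (▹-init (a ∘ suc) 𝟘 𝟘 k k<n))
      (Equivalence.to (regular-shiftDown {f = a ▹ 𝟘} (inj₂ (s≤s (ℕ.m≤m+n m 0))))
        (Equivalence.to (blockInjective⇔regular a (suc zero)) inj))

    regular-blockInjective : ∀ a → a zero ≈ 1# → a (fromℕ (2 * b)) ≈ 1# →
                             Regular n (middle a ▹ 𝟘) (suc m) (m + 0) → ∀ j → BlockInjective {2} {b} a j
    regular-blockInjective a a₀≈1 aₑ≈1 reg j = Equivalence.from (blockInjective⇔regular a j) (regular j)
      where
      regular : ∀ j → Regular (suc (toℕ j) * b) (a ▹ 𝟘) b (toℕ j * b)
      regular zero = ≡.subst (λ n → Regular n (a ▹ 𝟘) b 0) (≡.sym (ℕ.*-identityˡ b))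
        (regular-invertible (a ▹ 𝟘) b (1# , trans (*-identityˡ _) a₀≈1))
      regular (suc zero) = Equivalence.from (regular-shiftDown {f = a ▹ 𝟘} (inj₂ (s≤s (ℕ.m≤m+n m 0))))
        (regular-cong (λ k k<n → reflexive (≡.sym (▹-init (a ∘ suc) 𝟘 𝟘 k k<n))) reg)
      regular (suc (suc zero)) = regular-monic (a ▹ 𝟘) b (2 * b) (▹-<deg a)
        (trans (reflexive (≡.trans (≡.cong (a ▹ 𝟘) (≡.sym (toℕ-fromℕ (2 * b))))
                                   (▹-toℕ a 𝟘 (fromℕ (2 * b))))) aₑ≈1)

    module _ {ℓ₃ N} {_⊑_ : Rel (Vector Carrier b) ℓ₃} (Ψ : MonotoneBijection K b N _⊑_) where

      -- The map determines its coefficients, so different presentations of `F` count once.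
      coefficient-LBCA : ∀ {F} ((_ , (a , _) , _) : IsLBCA K b (2 * b) F) →
                         ∀ j → coefficient m (2 * b) F j ≈ a j
      coefficient-LBCA (f , (a , _ , _ , f≈) , F≈) j =
        trans (trans (F≈ _ zero) (f≈ _)) (coefficient-linearCA m (2 * b) a j)

      latinCubeLBCAs↔regular : Inverse (latinCubeLBCAs K Ψ) (regularSetoid n (suc m) (m + 0))
      latinCubeLBCAs↔regular = mkInverse (latinCubeLBCAs K Ψ) (regularSetoid n (suc m) (m + 0))
        (λ (F , lbca@(f , (a , a₀≈1 , aₑ≈1 , f≈) , F≈) , latin) →
          -- Taken from the values of `F` and not from its stored rule, so that pointwise equal maps
          -- give equal vectors.
          middle (coefficient m (2 * b) F) ,
          regular-cong (▹-cong 𝟘 𝟘 (λ i → sym (coefficient-LBCA lbca (suc (inject₁ i)))))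
            (middle-regular a (latin⇒blockInjective Ψ a (λ x i → trans (F≈ x i) (f≈ _)) latin (suc zero))))
        (λ (v , reg) → let a = extendCoefficients v in
          linearCA b (2 * b) a ,
          (linearRule a , (a , refl , extendCoefficients-last v , λ _ → refl) , λ _ _ → refl) ,
          blockInjective⇒latin Ψ a (λ _ _ → refl) (regular-blockInjective a refl (extendCoefficients-last v)
            (regular-cong (▹-cong 𝟘 𝟘 (λ i → sym (extendCoefficients-inner v i))) reg)))
        (λ _ _ F≈G i → F≈G _ zero)
        (λ (v , _) (w , _) v≈w x i → linearCA-cong b (2 * b) {x = x}
          (extendCoefficients-inverse {v} (extendCoefficients w) refl (extendCoefficients-last w)
            (λ i → trans (v≈w i) (sym (extendCoefficients-inner w i)))) (λ _ → refl) i)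
        (λ (v , _) i → trans (coefficient-linearCA m (2 * b) (extendCoefficients v) (suc (inject₁ i)))
                             (extendCoefficients-inner v i))
        (λ (F , lbca@(f , (a , a₀≈1 , aₑ≈1 , f≈) , F≈) , _) x i → trans
          (linearCA-cong b (2 * b) {x = x} (extendCoefficients-inverse a a₀≈1 aₑ≈1
            (λ i → coefficient-LBCA lbca (suc (inject₁ i)))) (λ _ → refl) i)
          (sym (trans (F≈ x i) (f≈ _))))

theorem1 : ∀ {c ℓ₁ ℓ₂ ℓ₃} (q : ℕ) → IsPrimePower q →
    (K : HeytingField c ℓ₁ ℓ₂) → HasCardinality (fieldSetoid K) q →
    (b : ℕ) .{{_ : NonZero b}} →
    (_⊑_ : Rel (Vector (HeytingField.Carrier K) b) ℓ₃) →
    IsTotalOrder (_≋_ (fieldSetoid K)) _⊑_ →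
    (Ψ : MonotoneBijection K b (q ^ b) _⊑_) →
    HasCardinality (latinCubeLBCAs K Ψ) (q ^ (2 * (b ∸ 1)) * (q ∸ 1))
-- The index of `0#` would lie in `Fin 0`.
theorem1 zero    _ K |K| _       _ _ _ with () ← Inverse.to |K| (HeytingField.0# K)
theorem1 (suc q) _ K |K| (suc m) _ _ Ψ =
  -- With 2b - 1 written as `suc (2 * m)`, `regularCount` unfolds to the required number.
  cardinality-≡ (≡.cong (λ n → regularCount q n (suc m)) (ℕ.+-suc m (m + 0)))
    (cardinality-↔ (LatinCubes.latinCubeLBCAs↔regular K m Ψ)
      (cardinality-regular (zero⊎unit |K|) 1≉0 |K|
        (m + 1 * suc m) (suc m) (m + 0) (≡.sym (ℕ.+-suc m (m + 0)))))
  where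
  open HeytingFieldProperties K
  open FiniteField commutativeRing
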